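{- For any integer $h\geq 1$, every graph $G$ with no path on $2h+1$ vertices is contained in $H\boxtimes K_{4h}$ for some graph $H$ with $\mathrm{pw}(H)\leq h-1$.
   Context: All graphs are simple, finite and undirected. "No path on $2h+1$ vertices" means that $G$ has no (not necessarily induced) subgraph isomorphic to the path on $2h+1$ vertices. "$G$ is contained in $G'$" means that $G$ is isomorphic to a subgraph of $G'$. The strong product $A\boxtimes B$ has vertex set $V(A)\times V(B)$, where distinct vertices $(v,x),(w,y)$ are adjacent if ($v=w$ and $xy\in E(B)$), or ($x=y$ and $vw\in E(A)$), or ($vw\in E(A)$ and $xy\in E(B)$). A path-decomposition of a graph $G$ is a sequence $(B_1,\dots,B_n)$ of subsets of $V(G)$ (bags) such that every edge of $G$ has both ends in some bag, and for every vertex $v$ the set $\{i: v\in B_i\}$ is a non-empty set of consecutive integers. Its width is $\max_i|B_i|-1$. The pathwidth $\mathrm{pw}(G)$ is the minimum width of a path-decomposition of $G$. -}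

module Defs where

open import Data.Fin.Base using (Fin; toℕ) renaming (_≤_ to _≤ᶠ_)
open import Data.Fin.Subset using (Subset; _∈_; ∣_∣)
open import Data.Integer.Base as ℤ using (ℤ; +_; 1ℤ)
open import Data.Nat.Base using (ℕ; suc; _⊔_)
open import Data.Nat.Properties using (1+n≢n)
open import Data.Product.Base using (∃-syntax; _×_; _,_)
open import Data.Sum.Base using (_⊎_; inj₁; inj₂; swap)
open import Data.Vec.Functional using (Vector; foldr; map)
open import Function.Definitions using (Injective)
open import Level using (0ℓ)
open import Relation.Binary.Core using (Rel)
open import Relation.Binary.Definitions using (Decidable; Irreflexive; Symmetric)
open import Relation.Binary.PropositionalEquality using (_≡_; _≢_; refl; sym; ≢-sym)

record SimpleGraph (V : Set) : Set₁ where
  field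
    Adj        : Rel V 0ℓ
    adj-sym    : Symmetric Adj
    adj-irrefl : Irreflexive _≡_ Adj

open SimpleGraph public

-- Finite graphs are taken with vertex set Fin order; adjacency is decidable, so
-- that the edge set is a finite set in the constructive sense as well.
record FiniteGraph : Set₁ where
  field
    order : ℕ
    graph : SimpleGraph (Fin order)
    adj?  : Decidable (Adj graph)

open FiniteGraph public

-- A is isomorphic to a (not necessarily induced) subgraph of B: the image of an
-- injective edge-preserving map, with the images of the edges of A, is such a subgraph.
record _⊑_ {V W : Set} (A : SimpleGraph V) (B : SimpleGraph W) : Set where
  field
    embed     : V → W
    injective : Injective _≡_ _≡_ embed
    preserves : ∀ {u v} → Adj A u v → Adj B (embed u) (embed v)

infix 4 _⊑_

path : (n : ℕ) → SimpleGraph (Fin n)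
path n = record
  { Adj        = λ i j → suc (toℕ i) ≡ toℕ j ⊎ suc (toℕ j) ≡ toℕ i
  ; adj-sym    = swap
  ; adj-irrefl = λ { refl (inj₁ e) → 1+n≢n e ; refl (inj₂ e) → 1+n≢n e }
  }

K : (n : ℕ) → SimpleGraph (Fin n)
K n = record
  { Adj        = _≢_
  ; adj-sym    = ≢-sym
  ; adj-irrefl = λ i≡j i≢j → i≢j i≡j
  }

-- Adjacent pairs are automatically distinct, since A and B are irreflexive.
_⊠_ : {V W : Set} → SimpleGraph V → SimpleGraph W → SimpleGraph (V × W)
A ⊠ B = record
  { Adj        = λ (v , x) (w , y) →
                   (v ≡ w × Adj B x y) ⊎ (x ≡ y × Adj A v w) ⊎ (Adj A v w × Adj B x y)
  ; adj-sym    = λ { (inj₁ (v≡w , xy))        → inj₁ (sym v≡w , adj-sym B xy)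
                   ; (inj₂ (inj₁ (x≡y , vw))) → inj₂ (inj₁ (sym x≡y , adj-sym A vw))
                   ; (inj₂ (inj₂ (vw , xy)))  → inj₂ (inj₂ (adj-sym A vw , adj-sym B xy))
                   }
  ; adj-irrefl = λ { refl (inj₁ (_ , xx))        → adj-irrefl B refl xx
                   ; refl (inj₂ (inj₁ (_ , vv))) → adj-irrefl A refl vv
                   ; refl (inj₂ (inj₂ (vv , _))) → adj-irrefl A refl vv
                   }
  }

infixl 7 _⊠_

record PathDecomposition {n : ℕ} (G : SimpleGraph (Fin n)) : Set where
  field
    size        : ℕ
    bag         : Vector (Subset n) size
    edge-cover  : ∀ {u v} → Adj G u v → ∃[ i ] (u ∈ bag i × v ∈ bag i)
    nonempty    : ∀ v → ∃[ i ] v ∈ bag i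
    consecutive : ∀ {v i j k} → i ≤ᶠ j → j ≤ᶠ k → v ∈ bag i → v ∈ bag k → v ∈ bag j

open PathDecomposition public

-- Integer-valued, since the graph without vertices has decompositions of width -1
-- (the maximum over the empty sequence of bags is 0).
width : ∀ {n} {G : SimpleGraph (Fin n)} → PathDecomposition G → ℤ
width D = + foldr _⊔_ 0 (map ∣_∣ (bag D)) ℤ.- 1ℤ

-- IsPathwidth G p says that pw(G) = p.
IsPathwidth : ∀ {n} → SimpleGraph (Fin n) → ℤ → Set
IsPathwidth G p = (∃[ D ] width {G = G} D ≡ p) × (∀ (D : PathDecomposition G) → p ℤ.≤ width D)

{-# OPTIONS --safe #-}
module Submission where

-- Two disjoint paths on 2h + 1 vertices, linked by a path between them, contain together a path on
-- at least 2h + 2 vertices: from each of the two, keep the longer side of the point of attachment.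
-- So, in a connected graph without a path on 2h + 3 vertices, they can only be linked by an edge
-- between their middle vertices, and three pairwise disjoint paths on 2h + 1 vertices would give a
-- path on (h + 1) + 1 + (h + 1) vertices through the middle of one of them. Hence in each component
-- at most two disjoint paths, with at most 4h + 2 vertices in total, meet all paths on 2h + 1
-- vertices. Iterating on what remains yields, for a graph without a path on 2h + 1 vertices, a rooted
-- forest of height h whose nodes are disjoint vertex sets of size at most 4h, with edges of the graph
-- only within nodes and between comparable nodes. The closure of such a forest has pathwidth at most
-- h - 1: its bags are the branches from the roots to the leaves, from left to right.

open import Defs
open import Data.Empty using (⊥-elim)
open import Data.Fin.Base as Fin using (Fin; toℕ; inject≤)
import Data.Fin.Properties as Fin
open import Data.Fin.Subset as Subset using (Subset; inside; outside; ⁅_⁆; _∪_; ⋃; ∣_∣)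
import Data.Fin.Subset.Properties as Subset
open import Data.Integer.Base as ℤ using (ℤ; +_; 1ℤ)
import Data.Integer.Properties as ℤ
open import Data.List.Base
  using (List; []; _∷_; _++_; _ʳ++_; length; lookup; map; reverse; take; cartesianProduct; allFin)
open import Data.List.Membership.Propositional using (_∈_; _∉_)
open import Data.List.Membership.Propositional.Properties
  using (∈-∃++; ∈-++⁻; ∈-++⁺ˡ; ∈-++⁺ʳ; ∈-lookup; ∈-filter⁺; ∈-cartesianProduct⁺; ∈-allFin;
         ∈-map⁺; ∈-map⁻)
import Data.List.Membership.Setoid.Properties as Membership
open import Data.List.Properties
  using (length-ʳ++; ++-ʳ++; ʳ++-defn; length-reverse; length-++; ++-assoc; length-take; length-map)
open import Data.List.Relation.Binary.Disjoint.DecPropositional using (disjoint?)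
open import Data.List.Relation.Binary.Disjoint.Propositional using (Disjoint)
import Data.List.Relation.Binary.Disjoint.Propositional.Properties as Disjoint
open import Data.List.Relation.Binary.Subset.Propositional using (_⊆_)
open import Data.List.Relation.Unary.All as All using (All; []; _∷_)
import Data.List.Relation.Unary.All.Properties as All
open import Data.List.Relation.Unary.AllPairs as AllPairs using ([]; _∷_)
open import Data.List.Relation.Unary.Any as Any using (here; there)
import Data.List.Relation.Unary.Any.Properties as Any
open import Data.List.Relation.Unary.Linked as Linked using (Linked; []; [-]; _∷_)
open import Data.List.Relation.Unary.Unique.DecPropositional using (unique?)
open import Data.List.Relation.Unary.Unique.Propositional using (Unique)
import Data.List.Relation.Unary.Unique.Propositional.Properties as Unique
open import Data.Nat.Base using (ℕ; zero; suc; _+_; _*_; _≤_; _<_; _⊔_; z≤n; s≤s; s≤s⁻¹)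
open import Data.Nat.Properties
open import Data.List.Extrema ≤-totalOrder using (argmax; argmax-sel; f[⊥]≤f[argmax]; f[xs]≤f[argmax])
open import Data.Nat.Solver using (module +-*-Solver)
open import Data.Product.Base using (Σ-syntax; ∃; ∃₂; _×_; _,_; proj₁; proj₂; uncurry)
open import Data.Sum.Base using (_⊎_; inj₁; inj₂)
open import Data.Unit.Base using (⊤)
import Data.Vec.Base as Vec
open import Data.Vec.Functional as Vector using (Vector)
open import Function.Base using (_∘_; id)
open import Level using (0ℓ)
open import Relation.Binary.Construct.Closure.ReflexiveTransitive
  using (Star; ε; _◅_; _◅◅_) renaming (reverse to reverseStar)
open import Relation.Binary.Core using (Rel)
open import Relation.Binary.Definitions as Binary using (DecidableEquality)
open import Relation.Binary.PropositionalEquality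
  using (_≡_; _≢_; refl; sym; trans; cong; subst; subst₂; ≢-sym; setoid; module ≡-Reasoning)
open import Relation.Nullary.Decidable using (Dec; yes; no; ¬?; map′; _×-dec_)
open import Relation.Nullary.Negation.Core using (¬_; contradiction)
open import Relation.Unary using (Pred; Decidable)

-- Paths as lists of vertices

lookup-linked : ∀ {A : Set} {R : Rel A 0ℓ} {xs} → Linked R xs → ∀ i j →
                suc (toℕ i) ≡ toℕ j → R (lookup xs i) (lookup xs j)
lookup-linked (r ∷ rs) Fin.zero    (Fin.suc Fin.zero) refl = r
lookup-linked (r ∷ rs) (Fin.suc i) (Fin.suc j)        eq   = lookup-linked rs i j (suc-injective eq)

lookup-injective : ∀ {A : Set} {xs : List A} → Unique xs → ∀ i j →
                   lookup xs i ≡ lookup xs j → i ≡ j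
lookup-injective (_ ∷ _)  Fin.zero    Fin.zero    _  = refl
lookup-injective (x ∷ _)  Fin.zero    (Fin.suc j) eq = contradiction eq (All.lookup x (∈-lookup j))
lookup-injective (x ∷ _)  (Fin.suc i) Fin.zero    eq = contradiction (sym eq) (All.lookup x (∈-lookup i))
lookup-injective (_ ∷ xs) (Fin.suc i) (Fin.suc j) eq = cong Fin.suc (lookup-injective xs i j eq)

take-linked : ∀ {A : Set} {R : Rel A 0ℓ} {xs} m → Linked R xs → Linked R (take m xs)
take-linked zero          _        = []
take-linked (suc m)       []       = []
take-linked (suc zero)    [-]      = [-]
take-linked (suc (suc m)) [-]      = [-]
take-linked (suc zero)    (r ∷ rs) = [-]
take-linked (suc (suc m)) (r ∷ rs) = r ∷ take-linked (suc m) rs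

module _ {V : Set} (G : SimpleGraph V) where

  -- The predicate `P` stands for the induced subgraph on the vertices still under consideration, so
  -- that removing vertices changes neither the vertex type nor the adjacency.
  record IsPath (P : Pred V 0ℓ) (xs : List V) : Set where
    constructor isPath
    field
      linked    : Linked (Adj G) xs
      unique    : Unique xs
      contained : All P xs

  ShorterThan : ℕ → Pred V 0ℓ → Set
  ShorterThan m P = ∀ {xs} → IsPath P xs → length xs < m

open IsPath

module _ {V : Set} {G : SimpleGraph V} where

  path⊑ : ∀ {P m xs} → IsPath G P xs → m ≤ length xs → path m ⊑ G
  path⊑ {xs = xs} p m≤ = record
    { embed     = λ i → lookup xs (inject≤ i m≤)
    ; injective = λ {i} {j} eq → Fin.inject≤-injective m≤ m≤ i j (lookup-injective (unique p) _ _ eq)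
    ; preserves = λ { {i} {j} (inj₁ eq) → step i j eq
                    ; {i} {j} (inj₂ eq) → adj-sym G (step j i eq) }
    }
    where
    step : ∀ i j → suc (toℕ i) ≡ toℕ j → Adj G (lookup xs (inject≤ i m≤)) (lookup xs (inject≤ j m≤))
    step i j eq = lookup-linked (linked p) _ _
      (trans (cong suc (Fin.toℕ-inject≤ i m≤)) (trans eq (sym (Fin.toℕ-inject≤ j m≤))))

  module _ {P : Pred V 0ℓ} where

    take-path : ∀ m {xs} → IsPath G P xs → IsPath G P (take m xs)
    take-path m (isPath l u a) = isPath (take-linked m l) (Unique.take⁺ m u) (All.take⁺ m a)

    tail-path : ∀ {x xs} → IsPath G P (x ∷ xs) → IsPath G P xs
    tail-path (isPath l u a) = isPath (Linked.tail l) (AllPairs.tail u) (All.tail a)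

    suffix-path : ∀ xs {ys} → IsPath G P (xs ++ ys) → IsPath G P ys
    suffix-path []       p = p
    suffix-path (x ∷ xs) p = suffix-path xs (tail-path p)

    cons-path : ∀ {x y ys} → P x → Adj G x y → x ∉ y ∷ ys →
                IsPath G P (y ∷ ys) → IsPath G P (x ∷ y ∷ ys)
    cons-path Px xy x∉ (isPath l u a) = isPath (xy ∷ l) (All.¬Any⇒All¬ _ x∉ ∷ u) (Px ∷ a)

    -- The paths are joined at their heads, hence the reversal of the first: its head moves in front
    -- of the second path, and its next vertex becomes the one to attach.
    glue-paths : ∀ {x xs y ys} → IsPath G P (x ∷ xs) → IsPath G P (y ∷ ys) → Adj G x y →
                 Disjoint (x ∷ xs) (y ∷ ys) → IsPath G P ((x ∷ xs) ʳ++ (y ∷ ys))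
    glue-paths {xs = []} p q xy disj =
      cons-path (All.head (contained p)) xy (λ x∈ → disj (here refl , x∈)) q
    glue-paths {xs = _ ∷ _} p q xy disj =
      glue-paths (tail-path p)
        (cons-path (All.head (contained p)) xy (λ x∈ → disj (here refl , x∈)) q)
        (adj-sym G (Linked.head (linked p)))
        λ { (v∈ , here refl) → Unique.Unique[x∷xs]⇒x∉xs (unique p) v∈
          ; (v∈ , there v∈′) → disj (there v∈ , v∈′) }

    reverse-path : ∀ {xs} → IsPath G P xs → IsPath G P (reverse xs)
    reverse-path {[]}         p = p
    reverse-path {_ ∷ []}     p = p
    reverse-path {x ∷ y ∷ xs} p =
      -- The reversal of `x ∷ y ∷ xs` is its tail, glued at `y` to the one-vertex path `x`.
      glue-paths (tail-path p) (isPath [-] ([] ∷ []) (All.head (contained p) ∷ []))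
        (adj-sym G (Linked.head (linked p)))
        λ { (v∈ , here refl) → Unique.Unique[x∷xs]⇒x∉xs (unique p) v∈ }

    -- A path of more than k vertices that starts at v and stays in Q.
    record Ray (Q : List V) (k : ℕ) (v : V) : Set where
      field
        {rest} : List V
        isray  : IsPath G P (v ∷ rest)
        within : v ∷ rest ⊆ Q
        long   : k ≤ length rest

    open Ray

    weaken-ray : ∀ {Q Q′ j k v} → Q ⊆ Q′ → j ≤ k → Ray Q k v → Ray Q′ j v
    weaken-ray Q⊆ j≤k r = record
      { isray  = isray r
      ; within = Q⊆ ∘ within r
      ; long   = ≤-trans j≤k (long r)
      }

    forward-ray : ∀ as {v bs} → IsPath G P (as ++ v ∷ bs) → Ray (as ++ v ∷ bs) (length bs) v
    forward-ray as p = record { isray = suffix-path as p ; within = ∈-++⁺ʳ as ; long = ≤-refl }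

    backward-ray : ∀ as {v bs} → IsPath G P (as ++ v ∷ bs) → Ray (as ++ v ∷ bs) (length as) v
    backward-ray as {v} {bs} p = record
      { isray  = suffix-path (reverse bs) (subst (IsPath G P) reversed (reverse-path p))
      ; within = λ { (here refl) → ∈-++⁺ʳ as (here refl)
                 ; (there v∈) → ∈-++⁺ˡ (Any.reverse⁻ {xs = as} v∈) }
      ; long   = ≤-reflexive (sym (length-reverse as))
      }
      where
      reversed : reverse (as ++ v ∷ bs) ≡ reverse bs ++ v ∷ reverse as
      reversed = trans (++-ʳ++ as) (ʳ++-defn bs)

    private
      halves : ∀ as {v : V} {bs} h → suc (h + h) ≤ length (as ++ v ∷ bs) →
               h + h ≤ length as + length bs
      halves as {v} {bs} h le = s≤s⁻¹ (begin
        suc (h + h)                  ≤⟨ le ⟩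
        length (as ++ v ∷ bs)        ≡⟨ length-++ as ⟩
        length as + suc (length bs)  ≡⟨ +-suc (length as) (length bs) ⟩
        suc (length as + length bs)  ∎)
        where open ≤-Reasoning

    -- The two sides of `v` have together at least 2h vertices, so one of them has at least h.
    ray : ∀ {Q v} h → IsPath G P Q → suc (h + h) ≤ length Q → v ∈ Q → Ray Q h v
    ray h p le v∈ with as , bs , refl ← ∈-∃++ v∈
      with ≤-total h (length as) | ≤-total h (length bs)
    ... | inj₁ h≤ | _       = weaken-ray id h≤ (backward-ray as p)
    ... | inj₂ _  | inj₁ h≤ = weaken-ray id h≤ (forward-ray as p)
    ... | inj₂ a≤ | inj₂ b≤ = weaken-ray id
      (+-cancelˡ-≤ h h (length bs) (≤-trans (halves as h le) (+-monoˡ-≤ (length bs) a≤)))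
      (forward-ray as p)

    -- Only the middle vertex of a path on 2h + 1 vertices has no longer ray.
    longer-ray : ∀ {Q v w} h → IsPath G P Q → suc (h + h) ≤ length Q → v ∈ Q → w ∈ Q → v ≢ w →
                 Ray Q (suc h) v ⊎ Ray Q (suc h) w
    longer-ray {w = w} h p le v∈ w∈ v≢w with as , bs , refl ← ∈-∃++ v∈
      with ≤-<-connex (length as) h | ≤-<-connex (length bs) h
    ... | inj₂ h< | _       = inj₁ (weaken-ray id h< (backward-ray as p))
    ... | inj₁ _  | inj₂ h< = inj₁ (weaken-ray id h< (forward-ray as p))
    -- Here `v` is the middle vertex, with exactly h vertices on each side. The way from `w` through
    -- `v` to the far end passes `v` and the h vertices beyond it.
    ... | inj₁ a≤ | inj₁ b≤ = inj₂ (other (∈-++⁻ as w∈))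
      where
      Q = as ++ _ ∷ bs
      h≤a : h ≤ length as
      h≤a = +-cancelʳ-≤ h h (length as) (≤-trans (halves as h le) (+-monoʳ-≤ (length as) b≤))
      h≤b : h ≤ length bs
      h≤b = +-cancelˡ-≤ h h (length bs) (≤-trans (halves as h le) (+-monoˡ-≤ (length bs) a≤))
      beyond : ∀ as {v : V} {bs} → h ≤ length bs ⊎ h ≤ length as → suc h ≤ length (as ++ v ∷ bs)
      beyond as {bs = bs} (inj₁ h≤) = begin
        suc h                        ≤⟨ s≤s h≤ ⟩
        suc (length bs)              ≤⟨ m≤n+m _ (length as) ⟩
        length as + suc (length bs)  ≡⟨ length-++ as ⟨
        length (as ++ _ ∷ bs)        ∎
        where open ≤-Reasoning
      beyond as {bs = bs} (inj₂ h≤) = begin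
        suc h                        ≤⟨ s≤s h≤ ⟩
        suc (length as)              ≤⟨ s≤s (m≤m+n _ (length bs)) ⟩
        suc (length as + length bs)  ≡⟨ +-suc (length as) (length bs) ⟨
        length as + suc (length bs)  ≡⟨ length-++ as ⟨
        length (as ++ _ ∷ bs)        ∎
        where open ≤-Reasoning
      other : w ∈ as ⊎ w ∈ _ ∷ bs → Ray Q (suc h) w
      other (inj₁ w∈as) with as₁ , as₂ , refl ← ∈-∃++ w∈as =
        subst (λ Q → Ray Q (suc h) w) (sym eq) (weaken-ray id (beyond as₂ (inj₁ h≤b))
          (forward-ray as₁ (subst (IsPath G P) eq p)))
        where eq = ++-assoc as₁ (w ∷ as₂) (_ ∷ bs)
      other (inj₂ (here refl)) = contradiction refl v≢w
      other (inj₂ (there w∈bs)) with bs₁ , bs₂ , refl ← ∈-∃++ w∈bs =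
        subst (λ Q → Ray Q (suc h) w) eq (weaken-ray id (beyond as (inj₂ h≤a))
          (backward-ray (as ++ _ ∷ bs₁) (subst (IsPath G P) (sym eq) p)))
        where eq = ++-assoc as (_ ∷ bs₁) (w ∷ bs₂)

    glue-rays : ∀ {A B a b j k m} → ShorterThan G m P → Ray A j a → Ray B k b →
                Adj G a b → Disjoint A B → suc j + suc k < m
    glue-rays {a = a} {b} {j} {k} {m} short r s ab disj = begin-strict
      suc j + suc k                                 ≤⟨ +-mono-≤ (s≤s (long r)) (s≤s (long s)) ⟩
      suc (length (rest r)) + suc (length (rest s)) ≡⟨ length-ʳ++ (a ∷ rest r) ⟨
      length ((a ∷ rest r) ʳ++ (b ∷ rest s))        <⟨ short (glue-paths (isray r) (isray s) ab disj′) ⟩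
      m                                             ∎
      where
      open ≤-Reasoning
      disj′ : Disjoint (a ∷ rest r) (b ∷ rest s)
      disj′ (v∈ , v∈′) = disj (within r v∈ , within s v∈′)

    -- Disjoint long paths in a connected graph without a path on 2h + 3 vertices

    Step : Rel V 0ℓ
    Step u v = P u × P v × Adj G u v

    module _ (_≟_ : DecidableEquality V) (h : ℕ) (short : ShorterThan G (3 + (h + h)) P) where

      open import Data.List.Membership.DecPropositional _≟_ using (_∈?_)

      private
        -- Gluing a ray with at least h + 1 vertices to one with at least h + 2 would give a path on
        -- at least 2h + 3 vertices.
        too-long : ¬ suc h + suc (suc h) < 3 + (h + h)
        too-long lt = <-irrefl (cong suc (trans (+-suc h (suc h)) (cong suc (+-suc h h)))) lt

        too-long′ : ¬ suc (suc h) + suc h < 3 + (h + h)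
        too-long′ lt = <-irrefl (cong (suc ∘ suc) (+-suc h h)) lt

      -- Only rays are required of `A` and `Z`, not that they be paths: `Z` will be the union of two
      -- disjoint paths.
      module _ {A Z : List V} (A-ray : ∀ {v} → v ∈ A → Ray A h v) (Z-ray : ∀ {v} → v ∈ Z → Ray Z h v)
               (disj : Disjoint A Z) where

        -- A path outside A and Z, prolonged by h + 1 vertices of A.
        record Hair (ts : List V) : Set where
          field
            {root}  : List V
            ishair  : IsPath G P (ts ++ root)
            rooted  : root ⊆ A
            deep    : h < length root
            avoids  : ∀ {v} → v ∈ ts → v ∉ A × v ∉ Z

        open Hair

        -- A walk may return to a vertex of the hair that it has grown; the hair is then shortened
        -- so as to start there.
        cut : ∀ {x ts} → x ∈ ts → Hair ts → ∃ λ ts′ → Hair (x ∷ ts′)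
        cut {ts = _ ∷ ts} (here refl) r = ts , r
        cut (there x∈) r = cut x∈ (record
          { ishair  = tail-path (ishair r)
          ; rooted  = rooted r
          ; deep    = deep r
          ; avoids  = avoids r ∘ there
          })

        grow : ∀ {x y ts} → Step x y → y ∉ A → y ∉ Z → Hair (x ∷ ts) → ∃ λ ts′ → Hair (y ∷ ts′)
        grow {x} {y} {ts} (_ , Py , xy) y∉A y∉Z r with y ∈? x ∷ ts
        ... | yes y∈ = cut y∈ r
        ... | no  y∉ = x ∷ ts , record
          { ishair  = cons-path Py (adj-sym G xy) y∉′ (ishair r)
          ; rooted  = rooted r
          ; deep    = deep r
          ; avoids  = λ { (here refl) → y∉A , y∉Z ; (there v∈) → avoids r v∈ }
          }
          where
          y∉′ : y ∉ x ∷ ts ++ root r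
          y∉′ y∈ with ∈-++⁻ (x ∷ ts) y∈
          ... | inj₁ y∈ts   = y∉ y∈ts
          ... | inj₂ y∈root = y∉A (rooted r y∈root)

        sprout : ∀ {x y} → Step x y → x ∈ A → y ∉ A → y ∉ Z → Hair (y ∷ [])
        sprout (_ , Py , xy) x∈A y∉A y∉Z = record
          { ishair  = cons-path Py (adj-sym G xy) (y∉A ∘ within (A-ray x∈A)) (isray (A-ray x∈A))
          ; rooted  = within (A-ray x∈A)
          ; deep    = s≤s (long (A-ray x∈A))
          ; avoids  = λ { (here refl) → y∉A , y∉Z }
          }

        -- With `x` itself, the hair is a ray with at least h + 2 vertices, which the h + 1 vertices
        -- of a ray from `z` would complete to a path on 2h + 3 vertices.
        hair-avoids : ∀ {x z ts} → Hair (x ∷ ts) → z ∈ Z → ¬ Adj G x z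
        hair-avoids {x} {z} {ts} r z∈Z xz = too-long′ (glue-rays short x-ray (Z-ray z∈Z) xz disj′)
          where
          x-ray : Ray (x ∷ ts ++ root r) (suc h) x
          x-ray = record
            { isray  = ishair r
            ; within = id
            ; long   = begin
                suc h                       ≤⟨ deep r ⟩
                length (root r)             ≤⟨ m≤n+m _ (length ts) ⟩
                length ts + length (root r) ≡⟨ length-++ ts ⟨
                length (ts ++ root r)       ∎
            }
            where open ≤-Reasoning
          disj′ : Disjoint (x ∷ ts ++ root r) Z
          disj′ (v∈ , v∈Z) with ∈-++⁻ (x ∷ ts) v∈
          ... | inj₁ v∈ts   = proj₂ (avoids r v∈ts) v∈Z
          ... | inj₂ v∈root = disj (rooted r v∈root , v∈Z)

        -- A walk that leaves A grows a hair, and a hair next to Z would yield a path on 2h + 3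
        -- vertices, so the walk can only get from A to Z by an edge.
        crossing : ∀ {x z} → x ∈ A ⊎ ∃ (λ ts → Hair (x ∷ ts)) → Star Step x z → z ∈ Z →
                   ∃₂ λ a b → a ∈ A × b ∈ Z × Adj G a b
        crossing (inj₁ x∈A)     ε z∈Z = contradiction (x∈A , z∈Z) disj
        crossing (inj₂ (_ , r)) ε z∈Z = contradiction z∈Z (proj₂ (avoids r (here refl)))
        crossing x (_◅_ {j = y} e walk) z∈Z with y ∈? A | y ∈? Z
        -- Each time the walk is in `A` it starts afresh, without a hair.
        crossing x e@(_ ◅ walk) z∈Z | yes y∈A | _ = crossing (inj₁ y∈A) walk z∈Z
        crossing (inj₁ x∈A)     ((_ , _ , xy) ◅ _) _ | no _ | yes y∈Z = _ , _ , x∈A , y∈Z , xy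
        crossing (inj₂ (_ , r)) ((_ , _ , xy) ◅ _) _ | no _ | yes y∈Z =
          contradiction xy (hair-avoids r y∈Z)
        crossing (inj₁ x∈A)     (e ◅ walk) z∈Z | no y∉A | no y∉Z =
          crossing (inj₂ (_ , sprout e x∈A y∉A y∉Z)) walk z∈Z
        crossing (inj₂ (_ , r)) (e ◅ walk) z∈Z | no y∉A | no y∉Z =
          crossing (inj₂ (grow e y∉A y∉Z r)) walk z∈Z

      record LongPath (Q : List V) : Set where
        field
          ispath   : IsPath G P Q
          spanning : suc (h + h) ≤ length Q

      open LongPath

      -- Either the path can go through x = x′, or one of x and x′ is not the middle vertex of X.
      no-hub : ∀ {A X B a x x′ b} → LongPath A → LongPath X → LongPath B →
               Disjoint A X → Disjoint A B → Disjoint X B →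
               a ∈ A → x ∈ X → Adj G a x → x′ ∈ X → b ∈ B → ¬ Adj G x′ b
      no-hub {A} {X} {B} {a} {x} {x′} {b} pA pX pB AX AB XB a∈ x∈ ax x′∈ b∈ x′b with x ≟ x′
      ... | yes refl = too-long (glue-rays short a-ray x-ray ax disj′)
        where
        a-ray : Ray A h a
        a-ray = ray h (ispath pA) (spanning pA) a∈
        b-ray : Ray B h b
        b-ray = ray h (ispath pB) (spanning pB) b∈
        x-ray : Ray (x ∷ B) (suc h) x
        x-ray = record
          { isray  = cons-path (All.lookup (contained (ispath pX)) x∈) x′b
                       (λ x∈b → XB (x∈ , within b-ray x∈b)) (isray b-ray)
          ; within = λ { (here refl) → here refl ; (there v∈) → there (within b-ray v∈) }
          ; long   = s≤s (long b-ray)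
          }
        disj′ : Disjoint A (x ∷ B)
        disj′ (v∈ , here refl) = AX (v∈ , x∈)
        disj′ (v∈ , there v∈B) = AB (v∈ , v∈B)
      ... | no x≢x′ with longer-ray h (ispath pX) (spanning pX) x∈ x′∈ x≢x′
      ... | inj₁ x-ray  =
        too-long (glue-rays short (ray h (ispath pA) (spanning pA) a∈) x-ray ax AX)
      ... | inj₂ x′-ray =
        too-long′ (glue-rays short x′-ray (ray h (ispath pB) (spanning pB) b∈) x′b XB)

      private
        long-nonempty : ∀ {Q} → LongPath Q → ∃ (_∈ Q)
        long-nonempty {_ ∷ _} _ = _ , here refl
        long-nonempty {[]} p with () ← spanning p

        disjoint-++ : ∀ {A B C : List V} → Disjoint A B → Disjoint A C → Disjoint A (B ++ C)
        disjoint-++ {B = B} AB AC (v∈A , v∈) with ∈-++⁻ B v∈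
        ... | inj₁ v∈B = AB (v∈A , v∈B)
        ... | inj₂ v∈C = AC (v∈A , v∈C)

        ++-ray : ∀ {B C} → LongPath B → LongPath C → ∀ {v} → v ∈ B ++ C → Ray (B ++ C) h v
        ++-ray {B} pB pC v∈ with ∈-++⁻ B v∈
        ... | inj₁ v∈B = weaken-ray ∈-++⁺ˡ ≤-refl (ray h (ispath pB) (spanning pB) v∈B)
        ... | inj₂ v∈C = weaken-ray (∈-++⁺ʳ B) ≤-refl (ray h (ispath pC) (spanning pC) v∈C)

      -- A walk from `A` to `B` may meet `C` first, so `crossing` is applied to the union of `B` and
      -- `C`.
      exit : ∀ {A B C} → LongPath A → LongPath B → LongPath C → Disjoint A B → Disjoint A C →
             (∀ {u v} → u ∈ A → v ∈ B → Star Step u v) →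
             ∃₂ λ a b → a ∈ A × (b ∈ B ⊎ b ∈ C) × Adj G a b
      exit {A} {B} {C} pA pB pC AB AC conn
        with a , a∈ ← long-nonempty pA | b , b∈ ← long-nonempty pB
        with u , v , u∈ , v∈ , uv ← crossing
               (ray h (ispath pA) (spanning pA)) (++-ray pB pC)
               (disjoint-++ AB AC) (inj₁ a∈) (conn a∈ b∈) (∈-++⁺ˡ b∈)
        = u , v , u∈ , ∈-++⁻ B v∈ , uv

      -- `A` has an edge to one of the other two paths, and the third has an edge to one of these
      -- two. So the three are linked in a row, and the one in the middle is a hub.
      no-three-disjoint : ∀ {A B C} → LongPath A → LongPath B → LongPath C →
                          Disjoint A B → Disjoint A C → Disjoint B C →
                          ¬ (∀ {u v} → u ∈ A ++ B ++ C → v ∈ A ++ B ++ C → Star Step u v)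
      no-three-disjoint {A} {B} {C} pA pB pC AB AC BC conn
        with exit pA pB pC AB AC (λ u∈ v∈ → conn (∈-++⁺ˡ u∈) (∈-++⁺ʳ A (∈-++⁺ˡ v∈)))
      ... | a , b , a∈ , inj₁ b∈B , ab
        with exit pC pA pB (Disjoint.sym AC) (Disjoint.sym BC)
               (λ u∈ v∈ → conn (∈-++⁺ʳ A (∈-++⁺ʳ B u∈)) (∈-++⁺ˡ v∈))
      ...   | c , d , c∈ , inj₁ d∈A , cd =
              no-hub pC pA pB (Disjoint.sym AC) (Disjoint.sym BC) AB c∈ d∈A cd a∈ b∈B ab
      ...   | c , d , c∈ , inj₂ d∈B , cd =
              no-hub pC pB pA (Disjoint.sym BC) (Disjoint.sym AC) (Disjoint.sym AB)
                c∈ d∈B cd b∈B a∈ (adj-sym G ab)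
      no-three-disjoint {A} {B} {C} pA pB pC AB AC BC conn
          | a , c , a∈ , inj₂ c∈C , ac
        with exit pB pA pC (Disjoint.sym AB) BC
               (λ u∈ v∈ → conn (∈-++⁺ʳ A (∈-++⁺ˡ u∈)) (∈-++⁺ˡ v∈))
      ...   | b , d , b∈ , inj₁ d∈A , bd =
              no-hub pB pA pC (Disjoint.sym AB) BC AC b∈ d∈A bd a∈ c∈C ac
      ...   | b , d , b∈ , inj₂ d∈C , bd =
              no-hub pB pC pA BC (Disjoint.sym AB) (Disjoint.sym AC) b∈ d∈C bd c∈C a∈ (adj-sym G ac)

-- Components, exhaustive search and hitting sets

module _ {V : Set} (_≟_ : DecidableEquality V) {R : Rel V 0ℓ} (R-sym : Binary.Symmetric R) where

  Labels : List (V × V) → (V → V) → Set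
  Labels es c = All (λ (u , v) → c u ≡ c v) es × (∀ u v → c u ≡ c v → Star R u v)

  -- Each edge (u , v) in turn relabels the class of u by that of v.
  label-edges : ∀ {es} → All (uncurry R) es → ∃ (Labels es)
  label-edges [] = id , [] , λ { u .u refl → ε }
  label-edges {(a , b) ∷ es} (ab ∷ rs) with c , same , conn ← label-edges rs =
    relabel ∘ c , merged ∷ All.map (cong relabel) same , conn′
    where
    relabel : V → V
    relabel x with x ≟ c a
    ... | yes _ = c b
    ... | no  _ = x

    merged : relabel (c a) ≡ relabel (c b)
    merged with c a ≟ c a | c b ≟ c a
    ... | no ca≢ | _     = contradiction refl ca≢
    ... | yes _  | yes _ = refl
    ... | yes _  | no _  = refl

    conn′ : ∀ u v → relabel (c u) ≡ relabel (c v) → Star R u v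
    conn′ u v eq with c u ≟ c a | c v ≟ c a
    ... | yes ua | yes va = conn u v (trans ua (sym va))
    ... | yes ua | no _   = conn u a ua ◅◅ ab ◅ conn b v eq
    ... | no _   | yes va = reverseStar R-sym (conn v a va ◅◅ ab ◅ conn b u (sym eq))
    ... | no _   | no _   = conn u v eq

-- Makes membership in the same component decidable, as an equality of labels; the edges used are
-- all pairs related by `R`.
components : ∀ {n} {R : Rel (Fin n) 0ℓ} → Binary.Symmetric R → Binary.Decidable R →
             ∃ λ (c : Fin n → Fin n) →
               (∀ {u v} → R u v → c u ≡ c v) × (∀ u v → c u ≡ c v → Star R u v)
components {n} R-sym R?
  with c , same , conn ← label-edges Fin._≟_ R-sym
         (All.all-filter (uncurry R?) (cartesianProduct (allFin n) (allFin n))) =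
  c ,
  (λ r → All.lookup same (∈-filter⁺ (uncurry R?) (∈-cartesianProduct⁺ (∈-allFin _) (∈-allFin _)) r)) ,
  conn

-- Exhaustive search decides whether a further path on 2h + 1 vertices exists, so disjoint paths can
-- be collected greedily without excluded middle.
find-list : ∀ {n} m {Q : Pred (List (Fin n)) 0ℓ} → Decidable Q →
            Dec (∃ λ xs → length xs ≡ m × Q xs)
find-list zero    Q? = map′ (λ q → [] , refl , q) (λ { ([] , refl , q) → q }) (Q? [])
find-list (suc m) Q? = map′
  (λ (x , xs , len , q) → x ∷ xs , cong suc len , q)
  (λ { (x ∷ xs , len , q) → x , xs , suc-injective len , q })
  (Fin.any? λ x → find-list m (Q? ∘ (x ∷_)))

module _ (F : FiniteGraph) where

  private
    G = graph F
    V = Fin (order F)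

  isPath? : ∀ {P} → Decidable P → Decidable (IsPath G P)
  isPath? P? xs = map′ (λ (l , u , a) → isPath l u a) (λ (isPath l u a) → l , u , a)
    (Linked.linked? (adj? F) xs ×-dec unique? Fin._≟_ xs ×-dec All.all? P? xs)

  map-path : ∀ {P Q : Pred V 0ℓ} → (∀ {v} → P v → Q v) → ∀ {xs} → IsPath G P xs → IsPath G Q xs
  map-path f (isPath l u a) = isPath l u (All.map f a)

  -- The union of a maximal family of disjoint paths on 2h + 1 vertices.
  hitting-set : ∀ {P X : Pred V 0ℓ} h → ShorterThan G (3 + (h + h)) P →
                Decidable X → (∀ {v} → X v → P v) →
                (∀ {u v} → X u → X v → Star (Step {G = G} {P = P}) u v) →
                ∃ λ S → length S ≤ suc (h + h) + suc (h + h) ×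
                        (∀ {xs} → IsPath G X xs → length xs ≡ suc (h + h) → ¬ Disjoint xs S)
  hitting-set {P} {X} h short X? X⊆P conn with find-list (suc (h + h)) (isPath? X?)
  ... | no ∄A = [] , z≤n , λ p len _ → ∄A (_ , len , p)
  ... | yes (A , lenA , pA)
    with find-list (suc (h + h)) (λ xs → isPath? X? xs ×-dec disjoint? Fin._≟_ xs A)
  ... | no ∄B =
    A , ≤-trans (≤-reflexive lenA) (m≤m+n _ _) , λ p len disj → ∄B (_ , len , p , disj)
  -- Two paths suffice: a third one disjoint from both would contradict `no-three-disjoint`.
  ... | yes (B , lenB , pB , BA) = B ++ A , ≤-reflexive length-BA , λ {C} pC lenC CBA →
    no-three-disjoint Fin._≟_ h short (longPath pC lenC) (longPath pB lenB) (longPath pA lenA)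
      (λ (v∈C , v∈B) → CBA (v∈C , ∈-++⁺ˡ v∈B)) (λ (v∈C , v∈A) → CBA (v∈C , ∈-++⁺ʳ B v∈A)) BA
      λ u∈ v∈ → let all-X = All.++⁺ (contained pC) (All.++⁺ (contained pB) (contained pA)) in
                conn (All.lookup all-X u∈) (All.lookup all-X v∈)
    where
    length-BA : length (B ++ A) ≡ suc (h + h) + suc (h + h)
    length-BA rewrite length-++ B {A} | lenA | lenB = refl
    longPath : ∀ {xs} → IsPath G X xs → length xs ≡ suc (h + h) → LongPath Fin._≟_ h short xs
    longPath p len = record { ispath = map-path X⊆P p ; spanning = ≤-reflexive (sym len) }

-- Pathwidth: cliques and closures of forests

∣p∪q∣≤∣p∣+∣q∣ : ∀ {n} (p q : Subset n) → ∣ p ∪ q ∣ ≤ (∣ p ∣) + (∣ q ∣)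
∣p∪q∣≤∣p∣+∣q∣ Vec.[]            Vec.[]            = z≤n
∣p∪q∣≤∣p∣+∣q∣ (outside Vec.∷ p) (outside Vec.∷ q) = ∣p∪q∣≤∣p∣+∣q∣ p q
∣p∪q∣≤∣p∣+∣q∣ (outside Vec.∷ p) (inside  Vec.∷ q) =
  ≤-trans (s≤s (∣p∪q∣≤∣p∣+∣q∣ p q)) (≤-reflexive (sym (+-suc ∣ p ∣ ∣ q ∣)))
∣p∪q∣≤∣p∣+∣q∣ (inside  Vec.∷ p) (outside Vec.∷ q) = s≤s (∣p∪q∣≤∣p∣+∣q∣ p q)
∣p∪q∣≤∣p∣+∣q∣ (inside  Vec.∷ p) (inside  Vec.∷ q) =
  s≤s (≤-trans (∣p∪q∣≤∣p∣+∣q∣ p q) (+-monoʳ-≤ ∣ p ∣ (n≤1+n _)))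

module _ {n : ℕ} where

  elements : List (Fin n) → Subset n
  elements xs = ⋃ (map ⁅_⁆ xs)

  ∈-elements⁺ : ∀ {x xs} → x ∈ xs → x Subset.∈ elements xs
  ∈-elements⁺ {x} (here refl) = Subset.x∈p∪q⁺ (inj₁ (Subset.x∈⁅x⁆ x))
  ∈-elements⁺     (there x∈)  = Subset.x∈p∪q⁺ (inj₂ (∈-elements⁺ x∈))

  ∈-elements⁻ : ∀ {x} xs → x Subset.∈ elements xs → x ∈ xs
  ∈-elements⁻ []       x∈ = contradiction x∈ Subset.∉⊥
  ∈-elements⁻ (y ∷ xs) x∈ with Subset.x∈p∪q⁻ ⁅ y ⁆ (elements xs) x∈
  ... | inj₁ x∈y  = here (Subset.x∈⁅y⁆⇒x≡y y x∈y)
  ... | inj₂ x∈xs = there (∈-elements⁻ xs x∈xs)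

  ∣elements∣≤length : ∀ xs → ∣ elements xs ∣ ≤ length xs
  ∣elements∣≤length []       = ≤-reflexive (Subset.∣⊥∣≡0 n)
  ∣elements∣≤length (x ∷ xs) = begin
    ∣ ⁅ x ⁆ ∪ elements xs ∣          ≤⟨ ∣p∪q∣≤∣p∣+∣q∣ ⁅ x ⁆ (elements xs) ⟩
    (∣ ⁅ x ⁆ ∣) + (∣ elements xs ∣)  ≡⟨ cong (_+ (∣ elements xs ∣)) (Subset.∣⁅x⁆∣≡1 x) ⟩
    suc ∣ elements xs ∣              ≤⟨ s≤s (∣elements∣≤length xs) ⟩
    suc (length xs)                  ∎
    where open ≤-Reasoning

  unique⇒length≤∣p∣ : ∀ {xs} {p : Subset n} → Unique xs → (∀ {x} → x ∈ xs → x Subset.∈ p) →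
                      length xs ≤ ∣ p ∣
  unique⇒length≤∣p∣ []       _   = z≤n
  unique⇒length≤∣p∣ (x∉ ∷ u) xs⊆ = ≤-<-trans
    (unique⇒length≤∣p∣ u λ y∈ → Subset.x∈p∧x≢y⇒x∈p-y (xs⊆ (there y∈)) (≢-sym (All.lookup x∉ y∈)))
    (Subset.x∈p⇒∣p-x∣<∣p∣ (xs⊆ (here refl)))

least : ∀ {n} {P : Pred (Fin n) 0ℓ} → Decidable P → ∃ P → ∃ λ i → P i × (∀ {j} → P j → i Fin.≤ j)
least {suc n} P? (i , Pi) with P? Fin.zero
... | yes P0 = Fin.zero , P0 , λ _ → z≤n
least {suc n} P? (Fin.zero  , Pi) | no ¬P0 = contradiction Pi ¬P0
least {suc n} P? (Fin.suc i , Pi) | no ¬P0 with j , Pj , j≤ ← least (P? ∘ Fin.suc) (i , Pi) =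
  Fin.suc j , Pj , λ { {Fin.zero} P0 → contradiction P0 ¬P0 ; {Fin.suc k} Pk → s≤s (j≤ Pk) }

max≤ : ∀ {n k} (f : Vector ℕ n) → (∀ i → f i ≤ k) → Vector.foldr _⊔_ 0 f ≤ k
max≤ {zero}  f f≤ = z≤n
max≤ {suc n} f f≤ = ⊔-lub (f≤ Fin.zero) (max≤ (f ∘ Fin.suc) (f≤ ∘ Fin.suc))

≤max : ∀ {n} (f : Vector ℕ n) i → f i ≤ Vector.foldr _⊔_ 0 f
≤max f Fin.zero    = m≤m⊔n _ _
≤max f (Fin.suc i) = ≤-trans (≤max (f ∘ Fin.suc) i) (m≤n⊔m _ _)

module _ {n : ℕ} {G : SimpleGraph (Fin n)} (D : PathDecomposition G) where

  -- Helly property: the first bag of the clique vertex that appears last contains the clique.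
  clique-in-bag : ∀ x xs → (∀ {u v} → u ∈ x ∷ xs → v ∈ x ∷ xs → u ≢ v → Adj G u v) →
                  ∃ λ i → ∀ {v} → v ∈ x ∷ xs → v Subset.∈ bag D i
  clique-in-bag x xs clique = first-bag last , λ {v} v∈ → in-bag v∈
    where
    first : ∀ v → ∃ λ i → v Subset.∈ bag D i × (∀ {j} → v Subset.∈ bag D j → i Fin.≤ j)
    first v = least (λ i → v Subset.∈? bag D i) (nonempty D v)
    first-bag : Fin n → Fin (size D)
    first-bag = proj₁ ∘ first
    last : Fin n
    last = argmax (toℕ ∘ first-bag) x xs
    last∈ : last ∈ x ∷ xs
    last∈ with argmax-sel (toℕ ∘ first-bag) x xs
    ... | inj₁ eq = here eq
    ... | inj₂ l∈ = there l∈
    latest : ∀ {v} → v ∈ x ∷ xs → first-bag v Fin.≤ first-bag last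
    latest (here refl) = f[⊥]≤f[argmax] {f = toℕ ∘ first-bag} x xs
    latest (there v∈)  = All.lookup (f[xs]≤f[argmax] {f = toℕ ∘ first-bag} x xs) v∈
    in-bag : ∀ {v} → v ∈ x ∷ xs → v Subset.∈ bag D (first-bag last)
    in-bag {v} v∈ with v Fin.≟ last
    ... | yes refl = proj₁ (proj₂ (first v))
    ... | no v≢ with i , v∈i , last∈i ← edge-cover D (clique v∈ last∈ v≢) =
      consecutive D (latest v∈) (proj₂ (proj₂ (first last)) last∈i) (proj₁ (proj₂ (first v))) v∈i

  clique≤bags : ∀ {xs} → Unique xs → (∀ {u v} → u ∈ xs → v ∈ xs → u ≢ v → Adj G u v) →
                length xs ≤ Vector.foldr _⊔_ 0 (Vector.map ∣_∣ (bag D))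
  clique≤bags {[]}     _ _      = z≤n
  clique≤bags {x ∷ xs} u clique with i , xs⊆ ← clique-in-bag x xs clique =
    ≤-trans (unique⇒length≤∣p∣ u xs⊆) (≤max (Vector.map ∣_∣ (bag D)) i)

-- `combine` orders pairs lexicographically. On leaves this is the order from left to right, on
-- which the consecutiveness of the bags rests.
combine-cancelˡ-≤ : ∀ {m n} {c d : Fin m} (i j : Fin n) →
                    Fin.combine c i Fin.≤ Fin.combine d j → c Fin.≤ d
combine-cancelˡ-≤ i j le = ≮⇒≥ λ d<c → <⇒≱ (Fin.combine-monoˡ-< j i d<c) le

combine-cancelʳ-≤ : ∀ {m n} (c : Fin m) {i j : Fin n} →
                    Fin.combine c i Fin.≤ Fin.combine c j → i Fin.≤ j
combine-cancelʳ-≤ {n = n} c {i} {j} le =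
  +-cancelˡ-≤ (n * toℕ c) (toℕ i) (toℕ j)
    (subst₂ _≤_ (Fin.toℕ-combine c i) (Fin.toℕ-combine c j) le)

-- The forest of height h with b + 1 roots, in which each inner node has b + 1 children.
module Forest (b : ℕ) where

  nodes : ℕ → ℕ
  nodes zero    = 0
  nodes (suc h) = suc b * suc (nodes h)

  leaves : ℕ → ℕ
  -- The empty forest has one empty branch, so that a root with nothing below it still ends a
  -- branch.
  leaves zero    = 1
  leaves (suc h) = suc b * leaves h

  -- node h c zero is the root of the tree c, and node h c (suc x) is the node x of the forest below it.
  node : ∀ h → Fin (suc b) → Fin (suc (nodes h)) → Fin (nodes (suc h))
  node _ = Fin.combine

  branch : ∀ h → Fin (leaves h) → List (Fin (nodes h))
  branch zero    _ = []
  branch (suc h) i = let c , j = Fin.remQuot {suc b} (leaves h) i in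
                     map (node h c) (Fin.zero ∷ map Fin.suc (branch h j))

  branch-combine : ∀ h c j → branch (suc h) (Fin.combine c j) ≡
                             map (node h c) (Fin.zero ∷ map Fin.suc (branch h j))
  branch-combine h c j =
    cong (λ (c , j) → map (node h c) (Fin.zero ∷ map Fin.suc (branch h j))) (Fin.remQuot-combine c j)

  length-branch : ∀ h i → length (branch h i) ≡ h
  length-branch zero    i = refl
  length-branch (suc h) i = cong suc (begin
    length (map (node h c) (map Fin.suc xs))  ≡⟨ length-map (node h c) (map Fin.suc xs) ⟩
    length (map Fin.suc xs)                   ≡⟨ length-map Fin.suc xs ⟩
    length xs                                 ≡⟨ length-branch h _ ⟩
    h                                         ∎)
    where
    open ≡-Reasoning
    c = Fin.quotient {suc b} (leaves h) i
    xs = branch h (Fin.remainder {suc b} (leaves h) i)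

  branch-unique : ∀ h i → Unique (branch h i)
  branch-unique zero    i = []
  branch-unique (suc h) i = Unique.map⁺ (λ {x} {y} → Fin.combine-injectiveʳ c x c y)
    (All.map⁺ (All.universal (λ _ ()) _) ∷ Unique.map⁺ Fin.suc-injective (branch-unique h _))
    where c = Fin.quotient {suc b} (leaves h) i

  -- The nodes of a single tree that lie on the branch to its leaf `j`; its root lies on all
  -- branches.
  data Below {h} (j : Fin (leaves h)) : Fin (suc (nodes h)) → Set where
    root  : Below j Fin.zero
    child : ∀ {x} → x ∈ branch h j → Below j (Fin.suc x)

  ∈-branch⁺ : ∀ h c {j y} → Below {h} j y → node h c y ∈ branch (suc h) (Fin.combine c j)
  ∈-branch⁺ h c {j} {y} y≤ =
    subst (node h c y ∈_) (sym (branch-combine h c j)) (∈-map⁺ (node h c) (below y≤))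
    where
    below : ∀ {y} → Below {h} j y → y ∈ Fin.zero ∷ map Fin.suc (branch h j)
    below root       = here refl
    below (child x∈) = there (∈-map⁺ Fin.suc x∈)

  ∈-branch⁻ : ∀ h c {j x} → x ∈ branch (suc h) (Fin.combine c j) →
              ∃ λ y → x ≡ node h c y × Below {h} j y
  ∈-branch⁻ h c {j} {x} x∈
    with y , y∈ , eq ← ∈-map⁻ (node h c) (subst (x ∈_) (branch-combine h c j) x∈) = y , eq , below y∈
    where
    below : ∀ {y} → y ∈ Fin.zero ∷ map Fin.suc (branch h j) → Below j y
    below (here refl) = root
    below (there y∈) with _ , x∈ , refl ← ∈-map⁻ Fin.suc y∈ = child x∈

  -- If `i` and `k` are leaves of the same tree, then so is each leaf between them, by the
  -- lexicographic order. The root of that tree is on all its branches, and the induction hypothesis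
  -- treats the nodes below it.
  branch-convex : ∀ h {x i j k} → i Fin.≤ j → j Fin.≤ k →
                  x ∈ branch h i → x ∈ branch h k → x ∈ branch h j
  branch-convex (suc h) {x} {i} {j} {k} i≤j j≤k x∈i x∈k
    with c , i′ , refl ← Fin.combine-surjective {suc b} i
       | d , j′ , refl ← Fin.combine-surjective {suc b} j
       | e , k′ , refl ← Fin.combine-surjective {suc b} k
    with y , refl , y≤i ← ∈-branch⁻ h c {i′} x∈i | z , eq , z≤k ← ∈-branch⁻ h e {k′} x∈k
    with refl , refl ← Fin.combine-injective c y e z eq
    with refl ← Fin.≤-antisym {i = c} {j = d}
                  (combine-cancelˡ-≤ i′ j′ i≤j) (combine-cancelˡ-≤ j′ k′ j≤k)
    = ∈-branch⁺ h c (convex y≤i z≤k)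
    where
    convex : ∀ {y} → Below i′ y → Below k′ y → Below {h} j′ y
    convex root       root       = root
    convex (child x∈) (child x∈′) =
      child (branch-convex h (combine-cancelʳ-≤ c i≤j) (combine-cancelʳ-≤ c j≤k) x∈ x∈′)

  some-leaf : ∀ h → Fin (leaves h)
  some-leaf zero    = Fin.zero
  some-leaf (suc h) = Fin.combine {suc b} Fin.zero (some-leaf h)

  branch-cover : ∀ h x → ∃ λ i → x ∈ branch h i
  branch-cover (suc h) x with Fin.combine-surjective {suc b} x
  ... | c , Fin.zero  , refl = Fin.combine c (some-leaf h) , ∈-branch⁺ h c root
  ... | c , Fin.suc y , refl with j , y∈ ← branch-cover h y = Fin.combine c j , ∈-branch⁺ h c (child y∈)

  -- Being on a common branch amounts to being equal or one an ancestor of the other; in this form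
  -- each edge of the closure comes with a bag that contains it.
  Comparable : ∀ h → Rel (Fin (nodes h)) 0ℓ
  Comparable h x y = ∃ λ i → x ∈ branch h i × y ∈ branch h i

  closure : ℕ → FiniteGraph
  closure h = record
    { order = nodes h
    ; graph = record
      { Adj        = λ x y → x ≢ y × Comparable h x y
      ; adj-sym    = λ (x≢y , i , x∈ , y∈) → ≢-sym x≢y , i , y∈ , x∈
      ; adj-irrefl = λ x≡y (x≢y , _) → x≢y x≡y
      }
    ; adj?  = λ x y →
        ¬? (x Fin.≟ y) ×-dec Fin.any? λ i → (x ∈? branch h i) ×-dec (y ∈? branch h i)
    }
    where open import Data.List.Membership.DecPropositional Fin._≟_ using (_∈?_)

  branches : ∀ h → PathDecomposition (graph (closure h))
  branches h = record
    { size        = leaves h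
    ; bag         = elements ∘ branch h
    ; edge-cover  = λ (_ , i , x∈ , y∈) → i , ∈-elements⁺ x∈ , ∈-elements⁺ y∈
    ; nonempty    = λ x → let i , x∈ = branch-cover h x in i , ∈-elements⁺ x∈
    ; consecutive = λ {v} {i} {j} {k} i≤j j≤k v∈i v∈k → ∈-elements⁺
        (branch-convex h i≤j j≤k (∈-elements⁻ (branch h i) v∈i) (∈-elements⁻ (branch h k) v∈k))
    }

  branches-thin : ∀ h → Vector.foldr _⊔_ 0 (Vector.map ∣_∣ (bag (branches h))) ≤ h
  branches-thin h = max≤ (Vector.map ∣_∣ (bag (branches h))) λ i →
    ≤-trans (∣elements∣≤length (branch h i)) (≤-reflexive (length-branch h i))

  -- A branch is a clique on h vertices, so no path-decomposition is narrower than that by branches.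
  closure-pathwidth : ∀ h → Σ[ p ∈ ℤ ] (IsPathwidth (graph (closure h)) p × p ℤ.≤ + h ℤ.- 1ℤ)
  closure-pathwidth h = width (branches h) ,
    ((branches h , refl) ,
     λ D → ℤ.+-monoˡ-≤ (ℤ.- 1ℤ) (ℤ.+≤+ (≤-trans (branches-thin h) (h≤bags D)))) ,
    ℤ.+-monoˡ-≤ (ℤ.- 1ℤ) (ℤ.+≤+ (branches-thin h))
    where
    h≤bags : ∀ D → h ≤ Vector.foldr _⊔_ 0 (Vector.map ∣_∣ (bag D))
    h≤bags D = ≤-trans (≤-reflexive (sym (length-branch h (some-leaf h))))
      (clique≤bags D (branch-unique h (some-leaf h)) λ x∈ y∈ x≢y → x≢y , some-leaf h , x∈ , y∈)

-- Laying out a graph on a forest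

module _ (F : FiniteGraph) where

  private
    G = graph F
    n = order F
    V = Fin n

  open Forest n
  open import Data.List.Membership.DecPropositional {A = V} Fin._≟_ using (_∈?_)

  -- An embedding of the graph on `P` into the strong product of the closure with a complete graph
  -- on w vertices. A node is comparable with itself, so an edge may stay within a node.
  record Layout (h w : ℕ) (P : Pred V 0ℓ) : Set where
    field
      place          : ∀ v → P v → Fin (nodes h)
      slot           : ∀ v → P v → Fin w
      slot-injective : ∀ {u v} (p : P u) (q : P v) →
                       place u p ≡ place v q → slot u p ≡ slot v q → u ≡ v
      comparable     : ∀ {u v} (p : P u) (q : P v) →
                       Adj G u v → Comparable h (place u p) (place v q)

  open Layout

  module _ {P : Pred V 0ℓ} (P? : Decidable P) (h : ℕ) (short : ShorterThan G (3 + (h + h)) P) where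

    private
      step-sym : Binary.Symmetric (Step {G = G} {P})
      step-sym (pu , pv , uv) = pv , pu , adj-sym G uv

      classes = components step-sym (λ u v → P? u ×-dec P? v ×-dec adj? F u v)

    class : V → V
    class = proj₁ classes

    step⇒class≡ : ∀ {u v} → Step {G = G} {P} u v → class u ≡ class v
    step⇒class≡ = proj₁ (proj₂ classes)

    private
      hitting = λ c → hitting-set F {X = λ v → P v × class v ≡ c} h short
        (λ v → P? v ×-dec class v Fin.≟ c) proj₁
        (λ (_ , eq) (_ , eq′) → proj₂ (proj₂ classes) _ _ (trans eq (sym eq′)))

    removed : V → List V
    removed = proj₁ ∘ hitting

    ∣removed∣≤ : ∀ c → length (removed c) ≤ suc (h + h) + suc (h + h)
    ∣removed∣≤ = proj₁ ∘ proj₂ ∘ hitting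

    Kept : Pred V 0ℓ
    Kept v = P v × v ∉ removed (class v)

    kept? : Decidable Kept
    kept? v = P? v ×-dec ¬? (v ∈? removed (class v))

    path-class : ∀ {x xs} → IsPath G P (x ∷ xs) → All (λ v → class v ≡ class x) (x ∷ xs)
    path-class {xs = []}    _ = refl ∷ []
    path-class {xs = _ ∷ _} (isPath (xy ∷ l) (_ ∷ u) (px ∷ ps@(py ∷ _))) =
      refl ∷ All.map (λ eq → trans eq (sym (step⇒class≡ (px , py , xy)))) (path-class (isPath l u ps))

    -- A path of kept vertices lies in one component. If it had 2h + 1 or more vertices, its first
    -- 2h + 1 would meet the set removed from that component.
    kept-shorter : ShorterThan G (suc (h + h)) Kept
    kept-shorter {xs} p with length xs <? suc (h + h)
    ... | yes lt = lt
    kept-shorter {[]}     p | no ¬lt = contradiction (s≤s z≤n) ¬lt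
    kept-shorter {x ∷ xs} p | no ¬lt = contradiction (λ {v} → disj {v})
      (proj₂ (proj₂ (hitting (class x)))
        (isPath (linked q) (unique q) (All.zip (All.map proj₁ (contained q) , same-class)))
        (trans (length-take (suc (h + h)) (x ∷ xs)) (m≤n⇒m⊓n≡m (≮⇒≥ ¬lt))))
      where
      q : IsPath G Kept (x ∷ take (h + h) xs)
      q = take-path (suc (h + h)) p
      same-class : All (λ v → class v ≡ class x) (x ∷ take (h + h) xs)
      same-class = path-class (map-path F proj₁ q)
      disj : Disjoint (x ∷ take (h + h) xs) (removed (class x))
      disj (v∈ , v∈S) = proj₂ (All.lookup (contained q) v∈)
        (subst (λ c → _ ∈ removed c) (sym (All.lookup same-class v∈)) v∈S)

    -- The removed vertices of a component go to the root of its tree, the kept ones into the forest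
    -- below, as in `L`. An edge stays within one component, hence within one tree.
    extend-layout : ∀ {w} → 4 * suc h ≤ w → Layout h w Kept → Layout (suc h) w P
    extend-layout {w} 4h≤w L = record
      { place          = λ v p → place′ p (v ∈? removed (class v))
      ; slot           = λ v p → slot′ p (v ∈? removed (class v))
      ; slot-injective = λ p q → injective′ p q (_ ∈? _) (_ ∈? _)
      ; comparable     = λ p q uv → comparable′ p q (_ ∈? _) (_ ∈? _) (step⇒class≡ (p , q , uv)) uv
      }
      where
      -- There are at most 4h + 2 removed vertices in a component and at least 4h + 4 slots.
      fits : ∀ c → length (removed c) ≤ w
      fits c = begin
        length (removed c)               ≤⟨ ∣removed∣≤ c ⟩
        suc (h + h) + suc (h + h)        ≤⟨ m≤n+m _ 2 ⟩
        2 + (suc (h + h) + suc (h + h))  ≡⟨ solve 1 (λ h →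
          con 2 :+ ((con 1 :+ (h :+ h)) :+ (con 1 :+ (h :+ h))) := con 4 :* (con 1 :+ h)) refl h ⟩
        4 * suc h                        ≤⟨ 4h≤w ⟩
        w                                ∎
        where
        open ≤-Reasoning
        open +-*-Solver

      -- The tree 0 stays unused; it keeps the forest nonempty when G has no vertices.
      tree : V → Fin (suc n)
      tree v = Fin.suc (class v)

      place′ : ∀ {v} → P v → Dec (v ∈ removed (class v)) → Fin (nodes (suc h))
      place′ {v} p (yes _)  = node h (tree v) Fin.zero
      place′ {v} p (no v∉)  = node h (tree v) (Fin.suc (place L v (p , v∉)))

      slot′ : ∀ {v} → P v → Dec (v ∈ removed (class v)) → Fin w
      slot′ {v} p (yes v∈) = inject≤ (Any.index v∈) (fits (class v))
      slot′ {v} p (no v∉)  = slot L v (p , v∉)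

      index-injective : ∀ {u v c d} → c ≡ d → (u∈ : u ∈ removed c) (v∈ : v ∈ removed d) →
                        inject≤ (Any.index u∈) (fits c) ≡ inject≤ (Any.index v∈) (fits d) → u ≡ v
      index-injective {c = c} refl u∈ v∈ eq =
        Membership.index-injective (setoid V) u∈ v∈ (Fin.inject≤-injective (fits c) (fits c) _ _ eq)

      injective′ : ∀ {u v} (p : P u) (q : P v) u∈? v∈? →
                   place′ p u∈? ≡ place′ q v∈? → slot′ p u∈? ≡ slot′ q v∈? → u ≡ v
      injective′ {u} {v} p q (yes u∈) (yes v∈) eq = index-injective
        (Fin.suc-injective (Fin.combine-injectiveˡ (tree u) Fin.zero (tree v) Fin.zero eq)) u∈ v∈
      injective′ {u} {v} p q (yes u∈) (no v∉) eq = contradiction (Fin.combine-injectiveʳ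
        (tree u) Fin.zero (tree v) (Fin.suc (place L v (q , v∉))) eq) λ ()
      injective′ {u} {v} p q (no u∉) (yes v∈) eq = contradiction (Fin.combine-injectiveʳ
        (tree u) (Fin.suc (place L u (p , u∉))) (tree v) Fin.zero eq) λ ()
      injective′ {u} {v} p q (no u∉) (no v∉) eq =
        slot-injective L (p , u∉) (q , v∉) (Fin.suc-injective (Fin.combine-injectiveʳ
          (tree u) (Fin.suc (place L u (p , u∉))) (tree v) (Fin.suc (place L v (q , v∉))) eq))

      related : ∀ {c d j x y} → c ≡ d → Below {h} j x → Below {h} j y →
                Comparable (suc h) (node h c x) (node h d y)
      related {c} refl x≤ y≤ = _ , ∈-branch⁺ h c x≤ , ∈-branch⁺ h c y≤

      comparable′ : ∀ {u v} (p : P u) (q : P v) u∈? v∈? → class u ≡ class v → Adj G u v →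
                    Comparable (suc h) (place′ p u∈?) (place′ q v∈?)
      -- Both ends are at the same root, which is on the branch to any leaf of its tree.
      comparable′ p q (yes _) (yes _) eq _ = related {j = some-leaf h} (cong Fin.suc eq) root root
      comparable′ p q (yes _) (no v∉) eq _ with _ , v≤ ← branch-cover h (place L _ (q , v∉)) =
        related (cong Fin.suc eq) root (child v≤)
      comparable′ p q (no u∉) (yes _) eq _ with _ , u≤ ← branch-cover h (place L _ (p , u∉)) =
        related (cong Fin.suc eq) (child u≤) root
      comparable′ p q (no u∉) (no v∉) eq uv with _ , u≤ , v≤ ← comparable L (p , u∉) (q , v∉) uv =
        related (cong Fin.suc eq) (child u≤) (child v≤)

  -- Each round lowers the excluded number of path vertices by two and the height by one, while w
  -- stays fixed.
  layout : ∀ h {w P} → Decidable P → ShorterThan G (suc (h + h)) P → 4 * h ≤ w → Layout h w P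
  layout zero {P = P} P? short _ = record
    { place          = λ v p → ⊥-elim (empty p)
    ; slot           = λ v p → ⊥-elim (empty p)
    ; slot-injective = λ p → ⊥-elim (empty p)
    ; comparable     = λ p → ⊥-elim (empty p)
    }
    where
    -- For h = 0 the excluded path has a single vertex, so no vertex is left.
    empty : ∀ {v} → ¬ P v
    empty p = <-irrefl refl (short (isPath [-] ([] ∷ []) (p ∷ [])))
  layout (suc h) {P = P} P? short 4h≤w = extend-layout P? h short′ 4h≤w
    (layout h (kept? P? h short′) (kept-shorter P? h short′) (≤-trans (*-monoʳ-≤ 4 (n≤1+n h)) 4h≤w))
    where
    short′ : ShorterThan G (3 + (h + h)) P
    short′ p = <-≤-trans (short p) (≤-reflexive (cong (suc ∘ suc) (+-suc h h)))

-- From the layout to the strong product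

proposition4 : (h : ℕ) → 1 ≤ h →
    (G : FiniteGraph) → ¬ (path (2 * h + 1) ⊑ graph G) →
    Σ[ H ∈ FiniteGraph ]
    ( graph G ⊑ graph H ⊠ K (4 * h)
    × (Σ[ p ∈ ℤ ] (IsPathwidth (graph H) p × p ℤ.≤ + h ℤ.- 1ℤ)) )
proposition4 h _ G ¬path = closure h ,
  record
    { embed     = λ v → place L v _ , slot L v _
    ; injective = λ eq → slot-injective L _ _ (cong proj₁ eq) (cong proj₂ eq)
    ; preserves = preserves
    } ,
  closure-pathwidth h
  where
  -- Component labels are vertices of `G`, so its order bounds the number of children that a node
  -- has to offer.
  open Forest (order G)
  open Layout

  2h+1≡ : 2 * h + 1 ≡ suc (h + h)
  2h+1≡ = trans (+-comm (2 * h) 1) (cong (λ k → suc (h + k)) (+-identityʳ h))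

  short : ShorterThan (graph G) (suc (h + h)) (λ _ → ⊤)
  short p = ≰⇒> λ le → ¬path (path⊑ p (≤-trans (≤-reflexive 2h+1≡) le))

  L : Layout G h (4 * h) (λ _ → ⊤)
  L = layout G h (λ _ → yes _) short ≤-refl

  preserves : ∀ {u v} → Adj (graph G) u v →
              Adj (graph (closure h) ⊠ K (4 * h)) (place L u _ , slot L u _) (place L v _ , slot L v _)
  preserves {u} {v} uv with place L u _ Fin.≟ place L v _ | slot L u _ Fin.≟ slot L v _
  -- Adjacent vertices are distinct, so they cannot share both node and slot.
  ... | yes p≡ | yes s≡ = contradiction uv (adj-irrefl (graph G) (slot-injective L _ _ p≡ s≡))
  ... | yes p≡ | no  s≢ = inj₁ (p≡ , s≢)
  ... | no  p≢ | yes s≡ = inj₂ (inj₁ (s≡ , p≢ , comparable L _ _ uv))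
  ... | no  p≢ | no  s≢ = inj₂ (inj₂ ((p≢ , comparable L _ _ uv) , s≢))
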